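{- Let $\kappa$ be a regular uncountable cardinal. If $\kappa$ carries a uniform normal 2-precipitous ideal, then $\kappa\to_{hc}[\kappa]^2_{\omega,2}$.
   Context: An ideal $I$ on $\kappa$ is uniform if it contains every subset of $\kappa$ of size $<\kappa$; it is normal if for every sequence $\langle X_\alpha:\alpha<\kappa\rangle$ of members of $I$, the diagonal union $\{\beta<\kappa:\exists\alpha<\beta\ (\beta\in X_\alpha)\}$ is in $I$. The game $G_I$: Players Empty and Nonempty alternate, Empty moving first, producing a coordinatewise $\subseteq$-decreasing sequence $\langle (A_n,B_n):n\in\omega\rangle$ of pairs of $I$-positive sets; Nonempty wins iff there exist $\alpha<\beta$ with $\alpha\in\bigcap_n A_n$, $\beta\in\bigcap_n B_n$. $I$ is 2-precipitous if Empty has no winning strategy in $G_I$. A graph $(X,E)$ is highly connected if for every $Y\subseteq X$ with $|Y|<|X|$ the induced subgraph on $X\setminus Y$ is connected. For $k\in\omega$, $\kappa\to_{hc}[\kappa]^2_{\omega,k}$ means: for every $c:[\kappa]^2\to\omega$ there exist $H\in[\kappa]^\kappa$ and $K\in[\omega]^k$ such that $(H,c^{ -1}(K)\cap[H]^2)$ is highly connected. -}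

module Defs where

open import Level using (Level; suc)
open import Data.Bool using (Bool; true; false; not; T; _∨_)
open import Data.Fin using (Fin)
open import Data.List using (List; applyUpTo)
open import Data.Nat as ℕ using (ℕ)
open import Data.Product using (Σ; ∃-syntax; _×_; _,_; proj₁; proj₂)
open import Function.Base using (_∘_)
open import Function.Bundles using (_↣_; _↔_; _⇔_)
open import Induction.WellFounded using (WellFounded)
open import Relation.Binary.Core using (Rel)
open import Relation.Binary.Definitions using (Symmetric; Irreflexive)
open import Relation.Binary.Structures using (IsStrictTotalOrder)
open import Relation.Binary.PropositionalEquality using (_≡_; _≢_; refl; sym; subst)
open import Relation.Binary.Construct.Closure.ReflexiveTransitive using (Star)
open import Relation.Nullary using (¬_)
open import Relation.Nullary.Decidable using (⌊_⌋)

private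
  variable
    a b ℓ : Level

-- Subsets are characteristic functions, so that membership is
-- proof-irrelevant and the type El X has exactly one element per member of X.
-- In the presence of excluded middle this is the full power set.

Subset : Set a → Set a
Subset A = A → Bool

infix 4 _∈_ _∉_ _⊆_
infixr 6 _∪_

_∈_ : {A : Set a} → A → Subset A → Set
x ∈ X = T (X x)

_∉_ : {A : Set a} → A → Subset A → Set
x ∉ X = ¬ (x ∈ X)

_⊆_ : {A : Set a} → Subset A → Subset A → Set a
X ⊆ Y = ∀ x → x ∈ X → x ∈ Y

∅ : {A : Set a} → Subset A
∅ _ = false

full : {A : Set a} → Subset A
full _ = true

_∪_ : {A : Set a} → Subset A → Subset A → Subset A
(X ∪ Y) x = X x ∨ Y x

∁ : {A : Set a} → Subset A → Subset A
∁ X = not ∘ X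

El : {A : Set a} → Subset A → Set a
El {A = A} X = Σ A (_∈ X)

-- |A| < |B|
infix 4 _≺_
_≺_ : Set a → Set b → Set _
A ≺ B = (A ↣ B) × ¬ (A ↔ B)

-- A cardinal is presented as a well-ordered type whose proper initial
-- segments all have strictly smaller cardinality (an initial ordinal).

record Cardinal ℓ : Set (suc ℓ) where
  infix 4 _<_
  field
    Carrier            : Set ℓ
    _<_                : Rel Carrier ℓ
    isStrictTotalOrder : IsStrictTotalOrder _≡_ _<_
    wellFounded        : WellFounded _<_

  open IsStrictTotalOrder isStrictTotalOrder public using (_<?_)

  below : Carrier → Subset Carrier
  below α β = ⌊ β <? α ⌋

  field
    initial : ∀ α → El (below α) ≺ Carrier

module _ (κ : Cardinal ℓ) where
  open Cardinal κ renaming (Carrier to ∣κ∣)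

  Uncountable : Set ℓ
  Uncountable = ¬ (∣κ∣ ↣ ℕ)

  Cofinal : Subset ∣κ∣ → Set ℓ
  Cofinal X = ∀ α → ∃[ β ] (β ∈ X × ¬ (β < α))

  -- cf(κ) = κ, where cf(κ) is the least size of a cofinal subset.  This is
  -- regularity for infinite κ only; it is used together with Uncountable.
  Regular : Set ℓ
  Regular = ∀ X → Cofinal X → ¬ (El X ≺ ∣κ∣)

  -- Ideals are proper.  (On an improper ideal Empty has no legal first move in
  -- the game below, which would make 2-precipitousness vacuous.)
  record IsIdeal (I : Subset (Subset ∣κ∣)) : Set ℓ where
    field
      ∅-mem    : ∅ ∈ I
      ⊆-closed : ∀ X Y → X ⊆ Y → Y ∈ I → X ∈ I
      ∪-closed : ∀ X Y → X ∈ I → Y ∈ I → (X ∪ Y) ∈ I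
      proper   : full ∉ I

  Uniform : Subset (Subset ∣κ∣) → Set ℓ
  Uniform I = ∀ X → El X ≺ ∣κ∣ → X ∈ I

  IsDiagonalUnion : (∣κ∣ → Subset ∣κ∣) → Subset ∣κ∣ → Set ℓ
  IsDiagonalUnion X D = ∀ β → (β ∈ D) ⇔ (∃[ α ] (α < β × β ∈ X α))

  Normal : Subset (Subset ∣κ∣) → Set ℓ
  Normal I = ∀ X → (∀ α → X α ∈ I) → ∀ D → IsDiagonalUnion X D → D ∈ I

  module Game (I : Subset (Subset ∣κ∣)) where

    Move : Set ℓ
    Move = Subset ∣κ∣ × Subset ∣κ∣

    Positive : Move → Set
    Positive (A , B) = A ∉ I × B ∉ I

    _⊑_ : Move → Move → Set ℓ
    (A′ , B′) ⊑ (A , B) = A′ ⊆ A × B′ ⊆ B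

    -- p n is the n-th pair played; Empty plays the even-indexed pairs,
    -- Nonempty the odd-indexed ones.
    Run : Set ℓ
    Run = ℕ → Move

    -- The n-th move respects the rules, relative to the previous one.
    Legal : Run → ℕ → Set ℓ
    Legal p n = Positive (p n) × (∀ m → n ≡ ℕ.suc m → p n ⊑ p m)

    NonemptyWins : Run → Set ℓ
    NonemptyWins p = ∃[ α ] ∃[ β ] (α < β × (∀ n → α ∈ proj₁ (p n)) × (∀ n → β ∈ proj₂ (p n)))

    -- A strategy for Empty maps the list of all previous moves to the next one.
    Strategy : Set ℓ
    Strategy = List Move → Move

    Follows : Strategy → Run → Set ℓ
    Follows σ p = ∀ n → p (2 ℕ.* n) ≡ σ (applyUpTo p (2 ℕ.* n))

    -- Empty must answer every legal position with a legal move, and must win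
    -- every legal infinite run.
    Winning : Strategy → Set ℓ
    Winning σ = ∀ p → Follows σ p →
      (∀ n → (∀ m → m ℕ.< 2 ℕ.* n → Legal p m) → Legal p (2 ℕ.* n)) ×
      ((∀ n → Legal p n) → ¬ NonemptyWins p)

  TwoPrecipitous : Subset (Subset ∣κ∣) → Set ℓ
  TwoPrecipitous I = ¬ (∃[ σ ] Game.Winning I σ)

record Graph ℓ : Set (suc ℓ) where
  field
    Vertex : Set ℓ
    Edge   : Rel Vertex ℓ
    symm   : Symmetric Edge
    irrefl : Irreflexive _≡_ Edge

module _ (G : Graph ℓ) where
  open Graph G

  induced : Subset Vertex → Graph ℓ
  induced X = record
    { Vertex = El X
    ; Edge   = λ x y → Edge (proj₁ x) (proj₁ y)
    ; symm   = symm
    ; irrefl = λ { refl → irrefl refl }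
    }

  Connected : Set ℓ
  Connected = ∀ x y → Star Edge x y

HighlyConnected : Graph ℓ → Set ℓ
HighlyConnected G = ∀ Y → El Y ≺ Graph.Vertex G → Connected (induced G (∁ Y))

-- A function [A]² → ω, given as a symmetric binary function whose values on
-- the diagonal are ignored.
record Colouring (A : Set a) : Set a where
  field
    colour     : A → A → ℕ
    colour-sym : ∀ x y → colour x y ≡ colour y x

-- The graph (A , c⁻¹(K)).
colourGraph : {A : Set a} → Colouring A → Subset ℕ → Graph a
colourGraph {A = A} c K = record
  { Vertex = A
  ; Edge   = λ x y → x ≢ y × colour x y ∈ K
  ; symm   = λ { {x} {y} (x≢y , cxy∈K) → (x≢y ∘ sym) , subst (_∈ K) (colour-sym x y) cxy∈K }
  ; irrefl = λ x≡y e → proj₁ e x≡y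
  }
  where open Colouring c

-- κ →hc [κ]²_{ω,k}
HCPartition : Cardinal ℓ → ℕ → Set ℓ
HCPartition κ k =
  (c : Colouring ∣κ∣) →
  ∃[ H ] ∃[ K ] ((El H ↔ ∣κ∣) × (El K ↔ Fin k) × HighlyConnected (induced (colourGraph c K) H))
  where open Cardinal κ renaming (Carrier to ∣κ∣)

{-# OPTIONS --safe #-}

-- Call a pair (A , B) of positive sets i-saturated if any positive A′ ⊆ A and
-- B′ ⊆ B contain α ∈ A′, β ∈ B′ with α < β and c(α,β) = i.  Below every
-- positive pair there is a saturated one: otherwise Empty wins the game by
-- avoiding colour n at his n-th move.  Applying this twice, with the
-- coordinates swapped the second time, yields A, B such that (A , B) is
-- i-saturated and (B , A) is j-saturated.  By normality, for every positive
-- P ⊆ B almost every α ∈ A has positively many i-neighbours in P.  After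
-- deleting the exceptional points, two members α₁, α₂ of A are joined by an
-- i-coloured path α₁ – β₁ – α – β₂ – α₂ whose inner vertices avoid any given
-- small set, and each member of B has a positive set of j-neighbours in A; so
-- A ∪ B is highly connected in the colours i and j.
module Submission where

open import Level using (Level; Lift; lift; lower)
open import Axiom.ExcludedMiddle using (ExcludedMiddle)
open import Data.Bool using (true; false)
open import Data.Bool.Properties using (T?; T-irrelevant; T-∨)
open import Data.Fin using (Fin; zero; suc)
open import Data.List using (List; []; _∷_; length; applyUpTo)
open import Data.List.Properties using (length-applyUpTo)
open import Data.Nat as ℕ using (ℕ; zero; suc; ⌊_/2⌋)
open import Data.Nat.Properties using (_≟_; n≡⌊n+n/2⌋; +-identityʳ; n<1+n; 1+n≢n)
open import Data.Product using (∃-syntax; _×_; _,_; proj₁; proj₂; swap)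
open import Data.Sum using (_⊎_; inj₁; inj₂; [_,_]′)
open import Function.Base using (_∘_; id)
open import Function.Bundles using (_↔_; _↣_; mk↔ₛ′; mk↣; mk⇔; Equivalence)
open import Function.Properties.Inverse using (↔-sym; ↔-trans)
open import Relation.Binary.Construct.Closure.ReflexiveTransitive using (Star; ε; _◅_; _◅◅_; reverse)
open import Relation.Binary.PropositionalEquality using (_≡_; _≢_; refl; sym; trans; cong; subst)
open import Relation.Binary.Structures using (IsStrictTotalOrder)
open import Relation.Nullary using (¬_; Dec; yes; no; contradiction)
open import Relation.Nullary.Decidable using (⌊_⌋; toWitness; fromWitness; map′; ¬?; _×-dec_; _⊎-dec_; decidable-stable; toSum)
open import Relation.Unary using (Pred; Decidable)
open import Defs

private
  variable
    a p : Level
    A : Set a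

-- Subsets cut out by decidable predicates

⁅_⁆ : {P : Pred A p} → Decidable P → Subset A
⁅ P? ⁆ x = ⌊ P? x ⌋

∈⁅⁆⁻ : {P : Pred A p} (P? : Decidable P) {x : A} → x ∈ ⁅ P? ⁆ → P x
∈⁅⁆⁻ P? {x} = toWitness {a? = P? x}

∈⁅⁆⁺ : {P : Pred A p} (P? : Decidable P) {x : A} → P x → x ∈ ⁅ P? ⁆
∈⁅⁆⁺ P? {x} = fromWitness {a? = P? x}

∈-∪⁺ : {X Y : Subset A} {x : A} → x ∈ X ⊎ x ∈ Y → x ∈ X ∪ Y
∈-∪⁺ = Equivalence.from T-∨

∈-∪⁻ : {X Y : Subset A} {x : A} → x ∈ X ∪ Y → x ∈ X ⊎ x ∈ Y
∈-∪⁻ = Equivalence.to T-∨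

∈-∁⁺ : {X : Subset A} {x : A} → x ∉ X → x ∈ ∁ X
∈-∁⁺ {X = X} {x} x∉X with X x
... | true  = x∉X _
... | false = _

infixl 7 _∖_
_∖_ : Subset A → Subset A → Subset A
X ∖ Y = ⁅ (λ x → T? (X x) ×-dec ¬? (T? (Y x))) ⁆

∈-∖⁻ : {X Y : Subset A} {x : A} → x ∈ X ∖ Y → x ∈ X × x ∉ Y
∈-∖⁻ {X = X} {Y} = ∈⁅⁆⁻ (λ x → T? (X x) ×-dec ¬? (T? (Y x)))

∈-∖⁺ : {X Y : Subset A} {x : A} → x ∈ X → x ∉ Y → x ∈ X ∖ Y
∈-∖⁺ {X = X} {Y} x∈X x∉Y = ∈⁅⁆⁺ (λ x → T? (X x) ×-dec ¬? (T? (Y x))) (x∈X , x∉Y)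

El-≡ : {X : Subset A} {x y : El X} → proj₁ x ≡ proj₁ y → x ≡ y
El-≡ {x = x , p} {y = .x , q} refl = cong (x ,_) (T-irrelevant p q)

El↣ : (X : Subset A) → El X ↣ A
El↣ X = mk↣ {to = proj₁} El-≡

-- Two-element sets of colours

pair : ℕ → ℕ → Subset ℕ
pair i j = ⁅ (λ x → (x ≟ i) ⊎-dec (x ≟ j)) ⁆

∈-pair⁺ : ∀ i j {x} → x ≡ i ⊎ x ≡ j → x ∈ pair i j
∈-pair⁺ i j = ∈⁅⁆⁺ (λ x → (x ≟ i) ⊎-dec (x ≟ j))

∈-pair⁻ : ∀ i j {x} → x ∈ pair i j → x ≡ i ⊎ x ≡ j
∈-pair⁻ i j = ∈⁅⁆⁻ (λ x → (x ≟ i) ⊎-dec (x ≟ j))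

El-pair↔Fin2 : ∀ {i j} → i ≢ j → El (pair i j) ↔ Fin 2
El-pair↔Fin2 {i} {j} i≢j = mk↔ₛ′ to from to∘from from∘to
  where
  index : ∀ {x} → Dec (x ≡ i) → Fin 2
  index (yes _) = zero
  index (no _)  = suc zero

  to : El (pair i j) → Fin 2
  to (x , _) = index (x ≟ i)

  from : Fin 2 → El (pair i j)
  from zero       = i , ∈-pair⁺ i j (inj₁ refl)
  from (suc zero) = j , ∈-pair⁺ i j (inj₂ refl)

  to∘from : ∀ k → to (from k) ≡ k
  to∘from zero with i ≟ i
  ... | yes _  = refl
  ... | no i≢i = contradiction refl i≢i
  to∘from (suc zero) with j ≟ i
  ... | yes j≡i = contradiction (sym j≡i) i≢j
  ... | no _    = refl

  from-index : ∀ {x} → x ∈ pair i j → (x≟i : Dec (x ≡ i)) → proj₁ (from (index x≟i)) ≡ x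
  from-index _  (yes x≡i) = sym x≡i
  from-index x∈ (no x≢i)  = sym ([ (λ x≡i → contradiction x≡i x≢i) , id ]′ (∈-pair⁻ i j x∈))

  from∘to : ∀ x → from (to x) ≡ x
  from∘to (x , x∈) = El-≡ (from-index x∈ (x ≟ i))

⊇-pair : ∀ i j → ∃[ K ] ((El K ↔ Fin 2) × i ∈ K × j ∈ K)
⊇-pair i j with i ≟ j
... | no i≢j   = pair i j , El-pair↔Fin2 i≢j , ∈-pair⁺ i j (inj₁ refl) , ∈-pair⁺ i j (inj₂ refl)
-- `K` must have exactly two elements, so when the two colours coincide `suc i` fills the second
-- place.
... | yes refl = pair i (suc i) , El-pair↔Fin2 (1+n≢n ∘ sym) , i∈ , i∈
  where i∈ = ∈-pair⁺ i (suc i) (inj₁ refl)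

-- Reading off a position of the game

lastOr : A → List A → A
lastOr x []       = x
lastOr _ (y ∷ ys) = lastOr y ys

lastOr-applyUpTo : (x : A) (f : ℕ → A) (n : ℕ) → lastOr x (applyUpTo f (suc n)) ≡ f n
lastOr-applyUpTo x f zero    = refl
lastOr-applyUpTo x f (suc n) = lastOr-applyUpTo (f 0) (f ∘ suc) n

⌊2*n/2⌋≡n : ∀ n → ⌊ 2 ℕ.* n /2⌋ ≡ n
⌊2*n/2⌋≡n n = trans (cong (λ m → ⌊ n ℕ.+ m /2⌋) (+-identityʳ n)) (sym (n≡⌊n+n/2⌋ n))

module _ {ℓ : Level} (em : ExcludedMiddle ℓ) (κ : Cardinal ℓ) where
  open Cardinal κ renaming (Carrier to ∣κ∣)

  em₀ : ExcludedMiddle Level.zero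
  em₀ = map′ lower lift (em {Lift ℓ _})

  -- Small sets of vertices as subsets of the cardinal

  image : (H : Subset ∣κ∣) → Subset (El H) → Subset ∣κ∣
  image H Y = ⁅ (λ x → em₀ {∃[ x∈H ] ((x , x∈H) ∈ Y)}) ⁆

  ∈-image⁻ : ∀ H Y {x} → x ∈ image H Y → ∃[ x∈H ] ((x , x∈H) ∈ Y)
  ∈-image⁻ H Y = ∈⁅⁆⁻ (λ x → em₀ {∃[ x∈H ] ((x , x∈H) ∈ Y)})

  ∈-image⁺ : ∀ H Y (x : El H) → x ∈ Y → proj₁ x ∈ image H Y
  ∈-image⁺ H Y (x , x∈H) x∈Y = ∈⁅⁆⁺ (λ x → em₀ {∃[ x∈H ] ((x , x∈H) ∈ Y)}) (x∈H , x∈Y)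

  El-image↔ : ∀ H Y → El Y ↔ El (image H Y)
  El-image↔ H Y = mk↔ₛ′
    (λ (x , x∈Y) → proj₁ x , ∈-image⁺ H Y x x∈Y)
    (λ (x , x∈Y′) → (x , proj₁ (∈-image⁻ H Y x∈Y′)) , proj₂ (∈-image⁻ H Y x∈Y′))
    (λ _ → El-≡ refl)
    (λ _ → El-≡ (El-≡ refl))

  module _ (I : Subset (Subset ∣κ∣)) (isIdeal : IsIdeal κ I) where
    open IsIdeal isIdeal
    open Game κ I

    -- Positive sets

    ∖-positive : ∀ {P D} → P ∉ I → D ∈ I → (P ∖ D) ∉ I
    ∖-positive {P} {D} P∉I D∈I P∖D∈I =
      P∉I (⊆-closed P (P ∖ D ∪ D) P⊆ (∪-closed (P ∖ D) D P∖D∈I D∈I))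
      where
      P⊆ : P ⊆ (P ∖ D ∪ D)
      P⊆ x x∈P = ∈-∪⁺ {X = P ∖ D} {D} ([ inj₂ , inj₁ ∘ ∈-∖⁺ {X = P} {D} x∈P ]′ (toSum (T? (D x))))

    positive-nonempty : ∀ {P} → P ∉ I → ∃[ x ] (x ∈ P)
    positive-nonempty {P} P∉I with em {∃[ x ] (x ∈ P)}
    ... | yes ne = ne
    ... | no ¬ne = contradiction (⊆-closed P ∅ (λ x x∈P → ¬ne (x , x∈P)) ∅-mem) P∉I

    positive-avoids : ∀ {P D} → P ∉ I → D ∈ I → ∃[ x ] (x ∈ P × x ∉ D)
    positive-avoids {P} {D} P∉I D∈I with x , x∈ ← positive-nonempty (∖-positive P∉I D∈I) =
      x , ∈-∖⁻ {X = P} {D} x∈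

    -- The inclusion is injective, so without a bijection `P` would be smaller than the cardinal and
    -- uniformity would put it in `I`.
    positive-↔ : Uniform κ I → ∀ {P} → P ∉ I → El P ↔ ∣κ∣
    positive-↔ uniform {P} P∉I with em {El P ↔ ∣κ∣}
    ... | yes e = e
    ... | no ¬e = contradiction (uniform P (El↣ P , ¬e)) P∉I

    -- As `H` has full size, a bijection of the image with the whole cardinal would give one between
    -- `Y` and `H`.
    image-∈I : Uniform κ I → ∀ {H} → H ∉ I → ∀ Y → El Y ≺ El H → image H Y ∈ I
    image-∈I uniform {H} H∉I Y (_ , ¬Y↔H) = uniform (image H Y)
      ( El↣ (image H Y)
      , λ e → ¬Y↔H (↔-trans (El-image↔ H Y) (↔-trans e (↔-sym (positive-↔ uniform H∉I)))))

    ⊑-trans : ∀ {L M N} → L ⊑ M → M ⊑ N → L ⊑ N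
    ⊑-trans (f , g) (h , k) = (λ x → h x ∘ f x) , (λ x → k x ∘ g x)

    ⊑-refl : ∀ {M} → M ⊑ M
    ⊑-refl = (λ _ → id) , (λ _ → id)

    module _ (c : Colouring ∣κ∣) where
      open Colouring c

      -- Saturated pairs and the colour-avoiding strategy

      Hits : ℕ → Move → Set ℓ
      Hits i (A , B) = ∃[ α ] ∃[ β ] (α ∈ A × β ∈ B × α < β × colour α β ≡ i)

      Saturated : ℕ → Move → Set ℓ
      Saturated i M = ∀ M′ → Positive M′ → M′ ⊑ M → Hits i M′

      Saturated-⊑ : ∀ {i M M′} → M′ ⊑ M → Saturated i M → Saturated i M′
      Saturated-⊑ M′⊑M sat L L⁺ L⊑M′ = sat L L⁺ (⊑-trans L⊑M′ M′⊑M)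

      Avoids : ℕ → Move → Move → Set ℓ
      Avoids i M M′ = Positive M′ × M′ ⊑ M × ¬ Hits i M′

      avoid : ℕ → Move → Move
      avoid i M with em {∃[ M′ ] Avoids i M M′}
      ... | yes (M′ , _) = M′
      -- Repeating the previous pair keeps the strategy legal where no avoiding pair exists.
      ... | no _         = M

      avoid-legal : ∀ i {M} → Positive M → Positive (avoid i M) × avoid i M ⊑ M
      avoid-legal i {M} M⁺ with em {∃[ M′ ] Avoids i M M′}
      ... | yes (_ , M′⁺ , M′⊑M , _) = M′⁺ , M′⊑M
      ... | no _                     = M⁺ , ⊑-refl {M}

      avoid-avoids : ∀ i {M} → ∃[ M′ ] Avoids i M M′ → ¬ Hits i (avoid i M)
      avoid-avoids i {M} ex with em {∃[ M′ ] Avoids i M M′}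
      ... | yes (_ , _ , _ , ¬hits) = ¬hits
      ... | no ¬ex                  = contradiction ex ¬ex

      ¬Saturated⇒avoidable : ∀ {i M} → ¬ Saturated i M → ∃[ M′ ] Avoids i M M′
      ¬Saturated⇒avoidable {i} {M} ¬sat with em {∃[ M′ ] Avoids i M M′}
      ... | yes ex = ex
      ... | no ¬ex = contradiction
        (λ M′ M′⁺ M′⊑M → decidable-stable em λ ¬hits → ¬ex (M′ , M′⁺ , M′⊑M , ¬hits)) ¬sat

      -- Half the number of moves played is the index of Empty's turn, hence the colour to avoid.
      -- `M₀` stands in for the missing previous move at the opening.
      avoidance : Move → Strategy
      avoidance M₀ Ms = avoid ⌊ length Ms /2⌋ (lastOr M₀ Ms)

      avoidance-even : ∀ M₀ (p : Run) n → avoidance M₀ (applyUpTo p (2 ℕ.* n)) ≡ avoid n (lastOr M₀ (applyUpTo p (2 ℕ.* n)))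
      avoidance-even M₀ p n = cong (λ k → avoid k (lastOr M₀ (applyUpTo p (2 ℕ.* n))))
        (trans (cong ⌊_/2⌋ (length-applyUpTo p (2 ℕ.* n))) (⌊2*n/2⌋≡n n))

      -- Suppose `α` and `β` witness a win for Nonempty, and let `n` be their colour. They lie in
      -- the pair Empty played at turn `n`, which has no increasing pair of colour `n`.
      avoidance-winning : ∀ M₀ → Positive M₀ →
        (∀ i M → Positive M → M ⊑ M₀ → ¬ Saturated i M) → Winning (avoidance M₀)
      avoidance-winning M₀ M₀⁺ ¬sat p follows = legal , wins
        where
        p-even : ∀ n → p (2 ℕ.* n) ≡ avoid n (lastOr M₀ (applyUpTo p (2 ℕ.* n)))
        p-even n = trans (follows n) (avoidance-even M₀ p n)

        previous-positive : ∀ k → (∀ m → m ℕ.< k → Legal p m) → Positive (lastOr M₀ (applyUpTo p k))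
        previous-positive zero    _   = M₀⁺
        previous-positive (suc m) leg =
          subst Positive (sym (lastOr-applyUpTo M₀ p m)) (proj₁ (leg m (n<1+n m)))

        legal : ∀ n → (∀ m → m ℕ.< 2 ℕ.* n → Legal p m) → Legal p (2 ℕ.* n)
        legal n leg =
          subst Positive (sym (p-even n)) (proj₁ move) ,
          λ m 2n≡1+m → subst (_⊑ p m) (sym (p-even n))
            (subst (avoid n previous ⊑_)
              (trans (cong (lastOr M₀ ∘ applyUpTo p) 2n≡1+m) (lastOr-applyUpTo M₀ p m))
              (proj₂ move))
          where
          previous = lastOr M₀ (applyUpTo p (2 ℕ.* n))
          move = avoid-legal n (previous-positive (2 ℕ.* n) leg)

        wins : (∀ n → Legal p n) → ¬ NonemptyWins p
        wins leg (α , β , α<β , α∈ , β∈) =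
          avoid-avoids n (¬Saturated⇒avoidable (¬sat n _ previous⁺ (previous-⊑ (2 ℕ.* n))))
            (subst (Hits n) (p-even n) (α , β , α∈ (2 ℕ.* n) , β∈ (2 ℕ.* n) , α<β , refl))
          where
          n = colour α β
          previous⁺ = previous-positive (2 ℕ.* n) (λ m _ → leg m)

          -- Saturation is known to fail only below `M₀`, so the whole run has to stay there.
          p-⊑ : ∀ m → p m ⊑ M₀
          p-⊑ zero    = subst (_⊑ M₀) (sym (p-even 0)) (proj₂ (avoid-legal 0 M₀⁺))
          p-⊑ (suc m) = ⊑-trans {p (suc m)} {p m} {M₀} (proj₂ (leg (suc m)) m refl) (p-⊑ m)

          previous-⊑ : ∀ k → lastOr M₀ (applyUpTo p k) ⊑ M₀
          previous-⊑ zero    = ⊑-refl {M₀}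
          previous-⊑ (suc m) = subst (_⊑ M₀) (sym (lastOr-applyUpTo M₀ p m)) (p-⊑ m)

      saturated-below : TwoPrecipitous κ I → ∀ M₀ → Positive M₀ →
        ∃[ M ] (Positive M × M ⊑ M₀ × ∃[ i ] Saturated i M)
      saturated-below precipitous M₀ M₀⁺
        with em {∃[ M ] (Positive M × M ⊑ M₀ × ∃[ i ] Saturated i M)}
      ... | yes ex = ex
      ... | no ¬ex = contradiction
        (avoidance M₀ , avoidance-winning M₀ M₀⁺ λ i M M⁺ M⊑M₀ sat → ¬ex (M , M⁺ , M⊑M₀ , i , sat))
        precipitous

      -- Upward neighbourhoods and normality

      nbhd? : ∀ i α P → Decidable (λ β → β ∈ P × α < β × colour α β ≡ i)
      nbhd? i α P β = T? (P β) ×-dec (α <? β) ×-dec (colour α β ≟ i)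

      nbhd : ℕ → ∣κ∣ → Subset ∣κ∣ → Subset ∣κ∣
      nbhd i α P = ⁅ nbhd? i α P ⁆

      exceptional? : ∀ i A P → Decidable (λ α → α ∈ A × nbhd i α P ∈ I)
      exceptional? i A P α = T? (A α) ×-dec T? (I (nbhd i α P))

      exceptional : ℕ → Subset ∣κ∣ → Subset ∣κ∣ → Subset ∣κ∣
      exceptional i A P = ⁅ exceptional? i A P ⁆

      -- If the exceptional set E were positive, then E and P minus the diagonal
      -- union of the neighbourhoods of the points of E would miss colour i.
      exceptional-∈I : Normal κ I → ∀ {i A B} → Saturated i (A , B) →
        ∀ {P} → P ⊆ B → P ∉ I → exceptional i A P ∈ I
      exceptional-∈I normal {i} {A} {B} sat {P} P⊆B P∉I = decidable-stable (T? _) λ E∉I →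
        let α , β , α∈E , β∈P∖D , α<β , cαβ≡i =
              sat (E , P ∖ D) (E∉I , ∖-positive P∉I D∈I)
                ((λ _ → proj₁ ∘ ∈⁅⁆⁻ (exceptional? i A P)) , (λ x → P⊆B x ∘ proj₁ ∘ ∈-∖⁻ {X = P} {D}))
            β∈P , β∉D = ∈-∖⁻ {X = P} {D} β∈P∖D
        in β∉D (∈⁅⁆⁺ D? (α , α<β , ∈⁅⁆⁺ (X? α) (α∈E , ∈⁅⁆⁺ (nbhd? i α P) (β∈P , α<β , cαβ≡i))))
        where
        E = exceptional i A P

        -- Normality asks for a member of `I` at every index, but off `E` the neighbourhood may be
        -- positive. The conjunct `α ∈ E` makes the set empty there.
        X? : ∀ α → Decidable (λ β → α ∈ E × β ∈ nbhd i α P)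
        X? α β = T? (E α) ×-dec T? (nbhd i α P β)

        X∈I : ∀ α → ⁅ X? α ⁆ ∈ I
        X∈I α =
          [ (λ α∈E → ⊆-closed ⁅ X? α ⁆ (nbhd i α P) (λ _ → proj₂ ∘ ∈⁅⁆⁻ (X? α)) (proj₂ (∈⁅⁆⁻ (exceptional? i A P) α∈E)))
          , (λ α∉E → ⊆-closed ⁅ X? α ⁆ ∅ (λ _ → α∉E ∘ proj₁ ∘ ∈⁅⁆⁻ (X? α)) ∅-mem)
          ]′ (toSum (T? (E α)))

        D? : Decidable (λ β → ∃[ α ] (α < β × β ∈ ⁅ X? α ⁆))
        D? β = em

        D = ⁅ D? ⁆

        D∈I : D ∈ I
        D∈I = normal (λ α → ⁅ X? α ⁆) X∈I D λ β → mk⇔ (∈⁅⁆⁻ D?) (∈⁅⁆⁺ D?)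

      -- Shrinking `P` by `D` removes only points of `D` from the neighbourhood. Hence deleting
      -- exceptional points on one side does not spoil richness on the other.
      nbhd-∖-positive : ∀ {i α P D} → nbhd i α P ∉ I → D ∈ I → nbhd i α (P ∖ D) ∉ I
      nbhd-∖-positive {i} {α} {P} {D} N∉I D∈I N′∈I =
        ∖-positive N∉I D∈I (⊆-closed (nbhd i α P ∖ D) (nbhd i α (P ∖ D)) sub N′∈I)
        where
        sub : (nbhd i α P ∖ D) ⊆ nbhd i α (P ∖ D)
        sub x x∈ =
          let x∈N , x∉D = ∈-∖⁻ {X = nbhd i α P} {D} x∈
              x∈P , rest = ∈⁅⁆⁻ (nbhd? i α P) x∈N
          in ∈⁅⁆⁺ (nbhd? i α (P ∖ D)) (∈-∖⁺ {X = P} {D} x∈P x∉D , rest)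

      RichIn : ℕ → Subset ∣κ∣ → Subset ∣κ∣ → Set ℓ
      RichIn i A B = ∀ {α} → α ∈ A → nbhd i α B ∉ I

      rich-pair : Normal κ I → TwoPrecipitous κ I →
        ∃[ i ] ∃[ j ] ∃[ A ] ∃[ B ] (A ∉ I × Saturated i (A , B) × RichIn i A B × RichIn j B A)
      rich-pair normal precipitous
        with (A₁ , B₁) , (A₁∉I , B₁∉I) , _ , i , sat₁ ← saturated-below precipitous (full , full) (proper , proper)
        -- Neighbourhoods only look upward in the order. Swapping the coordinates gives points of
        -- `B₂` their larger neighbours in `A₂`, while `sat₁` is inherited by the smaller pair.
        with (B₂ , A₂) , (B₂∉I , A₂∉I) , B₂A₂⊑ , j , sat₂ ← saturated-below precipitous (B₁ , A₁) (B₁∉I , A₁∉I) =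
          i , j , A₂ ∖ EA , B₂ ∖ EB
        , ∖-positive A₂∉I EA∈I
        , Saturated-⊑ {M = A₂ , B₂} {A₂ ∖ EA , B₂ ∖ EB}
            ((λ _ → proj₁ ∘ ∈-∖⁻ {X = A₂} {EA}) , (λ _ → proj₁ ∘ ∈-∖⁻ {X = B₂} {EB})) sat
        , (λ {α} α∈ → nbhd-∖-positive {i} {α} {B₂} {EB} (rich i A₂ B₂ α∈) EB∈I)
        , (λ {β} β∈ → nbhd-∖-positive {j} {β} {A₂} {EA} (rich j B₂ A₂ β∈) EA∈I)
        where
        sat : Saturated i (A₂ , B₂)
        sat = Saturated-⊑ {M = A₁ , B₁} {A₂ , B₂} (swap B₂A₂⊑) sat₁

        EA = exceptional i A₂ B₂
        EB = exceptional j B₂ A₂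

        EA∈I : EA ∈ I
        EA∈I = exceptional-∈I normal sat (λ _ → id) B₂∉I

        EB∈I : EB ∈ I
        EB∈I = exceptional-∈I normal sat₂ (λ _ → id) A₂∉I

        rich : ∀ k A B {α} → α ∈ A ∖ exceptional k A B → nbhd k α B ∉ I
        rich k A B α∈ N∈I =
          let α∈A , α∉E = ∈-∖⁻ {X = A} {exceptional k A B} α∈
          in α∉E (∈⁅⁆⁺ (exceptional? k A B) (α∈A , N∈I))

      -- High connectivity of the union

      module _ (uniform : Uniform κ I) (normal : Normal κ I)
        (i j : ℕ) (A B : Subset ∣κ∣) (K : Subset ℕ) (i∈K : i ∈ K) (j∈K : j ∈ K)
        (A∉I : A ∉ I) (sat : Saturated i (A , B)) (A-rich : RichIn i A B) (B-rich : RichIn j B A) where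

        H : Subset ∣κ∣
        H = A ∪ B

        H∉I : H ∉ I
        H∉I H∈I = A∉I (⊆-closed A H (λ _ → ∈-∪⁺ {X = A} {B} ∘ inj₁) H∈I)

        module _ (Y : Subset (El H)) (Y≺H : El Y ≺ El H) where
          Γ : Graph ℓ
          Γ = induced (induced (colourGraph c K) H) (∁ Y)

          open Graph Γ

          Y′ : Subset ∣κ∣
          Y′ = image H Y

          Y′∈I : Y′ ∈ I
          Y′∈I = image-∈I uniform H∉I Y Y≺H

          point : Vertex → ∣κ∣
          point v = proj₁ (proj₁ v)

          vertex : ∀ {x} → x ∈ A ⊎ x ∈ B → x ∉ Y′ → Vertex
          vertex {x} x∈ x∉Y′ = (x , x∈H) , ∈-∁⁺ {X = Y} (x∉Y′ ∘ ∈-image⁺ H Y (x , x∈H))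
            where x∈H = ∈-∪⁺ {X = A} {B} x∈

          nbhd-edge : ∀ {k P u v} → k ∈ K → point v ∈ nbhd k (point u) P → Edge u v
          nbhd-edge {k} {P} {u} k∈K v∈N with _ , u<v , cuv≡k ← ∈⁅⁆⁻ (nbhd? k (point u) P) v∈N =
            (λ u≡v → irrefl-< u≡v u<v) , subst (_∈ K) (sym cuv≡k) k∈K
            where irrefl-< = IsStrictTotalOrder.irrefl isStrictTotalOrder

          undirected : ∀ {u v} → Star Edge u v → Star Edge v u
          undirected = reverse λ {u} {v} → symm {u} {v}

          A-linked : ∀ u v → point u ∈ A → point v ∈ A → Star Edge u v
          A-linked u v u∈A v∈A =
            let Pu = nbhd i (point u) B
                Pv = nbhd i (point v) B
                E P = exceptional i A P
                -- Richness makes the neighbourhood of an endpoint a positive subset of `B`, so it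
                -- can take the place of `P`.
                E∈I x x∈A = exceptional-∈I normal sat
                  (λ _ → proj₁ ∘ ∈⁅⁆⁻ (nbhd? i x B)) (A-rich x∈A)
                -- The middle vertex of the path must be exceptional for neither endpoint's
                -- neighbourhood and must survive the deletion of `Y`.
                α , α∈A , α∉ = positive-avoids A∉I
                  (∪-closed (E Pu) (E Pv ∪ Y′) (E∈I (point u) u∈A) (∪-closed (E Pv) Y′ (E∈I (point v) v∈A) Y′∈I))
                α∉EvY = α∉ ∘ ∈-∪⁺ {X = E Pu} {E Pv ∪ Y′} ∘ inj₂
                w = vertex (inj₁ α∈A) (α∉EvY ∘ ∈-∪⁺ {X = E Pv} {Y′} ∘ inj₂)
                u⟶w = two-steps u w (α∉ ∘ ∈-∪⁺ {X = E Pu} {E Pv ∪ Y′} ∘ inj₁ ∘ ∈⁅⁆⁺ (exceptional? i A Pu) ∘ (α∈A ,_))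
                v⟶w = two-steps v w (α∉EvY ∘ ∈-∪⁺ {X = E Pv} {Y′} ∘ inj₁ ∘ ∈⁅⁆⁺ (exceptional? i A Pv) ∘ (α∈A ,_))
            in u⟶w ◅◅ undirected v⟶w
            where
            -- The iterated neighbourhood consists of common `i`-neighbours above both points. Being
            -- positive, it has a member `z` outside `Y′`; the second edge is traversed downward,
            -- hence `symm`.
            two-steps : ∀ u w → nbhd i (point w) (nbhd i (point u) B) ∉ I → Star Edge u w
            two-steps u w N∉I =
              let β , β∈N , β∉Y′ = positive-avoids N∉I Y′∈I
                  β∈Pu = proj₁ (∈⁅⁆⁻ (nbhd? i (point w) (nbhd i (point u) B)) β∈N)
                  z = vertex (inj₂ (proj₁ (∈⁅⁆⁻ (nbhd? i (point u) B) β∈Pu))) β∉Y′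
              in _◅_ {j = z} (nbhd-edge {i} {B} {u} {z} i∈K β∈Pu)
                 (symm {w} {z} (nbhd-edge {i} {nbhd i (point u) B} {w} {z} i∈K β∈N) ◅ ε)

          A-reachable : ∀ u → ∃[ v ] (point v ∈ A × Star Edge u v)
          A-reachable u with ∈-∪⁻ {X = A} {B} (proj₂ (proj₁ u))
          ... | inj₁ u∈A = u , u∈A , ε
          ... | inj₂ u∈B =
            -- Colour `j` enters here: one of the positively many `j`-neighbours in `A` survives the
            -- deletion of `Y`.
            let α , α∈N , α∉Y′ = positive-avoids (B-rich u∈B) Y′∈I
                α∈A = proj₁ (∈⁅⁆⁻ (nbhd? j (point u) A) α∈N)
                v = vertex (inj₁ α∈A) α∉Y′
            in v , α∈A , nbhd-edge {j} {A} {u} {v} j∈K α∈N ◅ ε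

          connected : Connected Γ
          connected u v =
            let u′ , u′∈A , u⟶u′ = A-reachable u
                v′ , v′∈A , v⟶v′ = A-reachable v
            in u⟶u′ ◅◅ A-linked u′ v′ u′∈A v′∈A ◅◅ undirected v⟶v′

mainTheorem6 : {ℓ : Level} → ExcludedMiddle ℓ →
    (κ : Cardinal ℓ) → Regular κ → Uncountable κ →
    (∃[ I ] (IsIdeal κ I × Uniform κ I × Normal κ I × TwoPrecipitous κ I)) →
    HCPartition κ 2
mainTheorem6 em κ _ _ (I , isIdeal , uniform , normal , precipitous) c =
  let i , j , A , B , A∉I , sat , A-rich , B-rich = rich-pair em κ I isIdeal c normal precipitous
      K , K↔2 , i∈K , j∈K = ⊇-pair i j
  in A ∪ B , K
   , positive-↔ em κ I isIdeal uniform
       (H∉I em κ I isIdeal c uniform normal i j A B K i∈K j∈K A∉I sat A-rich B-rich)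
   , K↔2
   , connected em κ I isIdeal c uniform normal i j A B K i∈K j∈K A∉I sat A-rich B-rich
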